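{- Let $G=(V,E)$ be a graph, $\mathbf p=(p_e)_{e\in E}$ and $\boldsymbol\eta=(\eta_v)_{v\in V}$, where $0\le p_e\le1/2$ for all $e\in E$ and $\eta_v\ge0$ for all $v\in V$. Let $\mathcal S\subseteq E$ be a random sample from the subgraph-world model on $G$ with parameters $(\mathbf p,\boldsymbol\eta)$. Let $\mathcal R$ be obtained from $\mathcal S$ by adding each remaining edge $e\in E\setminus\mathcal S$ independently with probability $p_e/(1-p_e)$. Then the random subgraph $\mathcal R$ follows the distribution of the weighted random cluster model on $G$ with parameters $(2\mathbf p,\boldsymbol\lambda)$, where $\boldsymbol\lambda$ is determined by $\eta_v=\frac{1-\lambda_v}{1+\lambda_v}$ for all $v\in V$.
   Context: $G$ is a finite simple undirected graph. Subgraph-world model with parameters $(\mathbf p,\boldsymbol\eta)$: $\pi_{\mathrm{sg}}(S)\propto\prod_{e\in S}p_e\prod_{f\in E\setminus S}(1-p_f)\prod_{v\in\mathrm{odd}(S)}\eta_v$ for $S\subseteq E$, where $\mathrm{odd}(S)$ is the set of odd-degree vertices of $(V,S)$. Weighted random cluster model with parameters $(\mathbf q,\boldsymbol\lambda)$: $\pi_{\mathrm{wrc}}(S)\propto\prod_{e\in S}q_e\prod_{f\in E\setminus S}(1-q_f)\prod_{C\in\kappa(V,S)}(1+\prod_{u\in C}\lambda_u)$ for $S\subseteq E$, where $\kappa(V,S)$ is the set of connected components (as vertex sets) of $(V,S)$; the same formula is used for all parameter values arising in the statement. Here $2\mathbf p=(2p_e)_{e\in E}$. -}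

module Defs where

open import Level using (_⊔_; suc)
open import Algebra.Apartness.Bundles using (HeytingField)
open import Algebra.Bundles using (CommutativeRing)
import Algebra.Apartness.Properties.HeytingCommutativeRing as HeytingProperties
import Algebra.Properties.CommutativeMonoid.Sum as CommutativeMonoidSum
import Algebra.Properties.Ring as RingProperties
open import Data.Bool.Base using (if_then_else_; _∨_)
import Data.Bool.Properties as Bool
open import Data.Fin.Base as Fin using (Fin)
import Data.Fin.Properties as Fin
open import Data.Fin.Subset using (Subset; inside; outside; _∈_; _∪_; _∩_; ∁; ∣_∣)
open import Data.List.Base using (List; foldr; map; allFin; deduplicate)
open import Data.Nat.Base using (ℕ; _%_; _≡ᵇ_)
open import Data.Product.Base using (∃; _×_; _,_; proj₁; proj₂)
open import Data.Sum.Base using (_⊎_; inj₁; inj₂; [_,_]′)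
open import Data.Vec.Base using ([]; _∷_; lookup; tabulate; here; there)
open import Data.Vec.Properties using (≡-dec)
open import Function.Base using (_∘_)
open import Function.Definitions using (Injective)
open import Relation.Binary.Construct.Closure.ReflexiveTransitive using (Star; ε; _◅_; _◅◅_)
  renaming (gmap to starMap)
open import Relation.Binary.Core using (Rel)
open import Relation.Binary.Definitions using (Decidable; DecidableEquality)
open import Relation.Binary.PropositionalEquality.Core using (_≡_; refl)
open import Relation.Binary.Structures using (IsStrictPartialOrder)
open import Relation.Nullary.Decidable using (does; map′; _⊎-dec_; _×-dec_)
open import Relation.Nullary.Negation using (¬_; contradiction)

------------------------------------------------------------------------
-- Ordered fields

-- The real numbers enter only as a field with a compatible order, so an
-- arbitrary ordered field stands in for them. The order is linked to the
-- apartness relation and is not assumed decidable, so constructive reals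
-- are covered as well as ℚ and the classical reals.

record OrderedField c ℓ₁ ℓ₂ ℓ₃ : Set (suc (c ⊔ ℓ₁ ⊔ ℓ₂ ⊔ ℓ₃)) where
  field
    heytingField : HeytingField c ℓ₁ ℓ₂

  open HeytingField heytingField public
    renaming (refl to ≈-refl; sym to ≈-sym; trans to ≈-trans)

  commutativeRing : CommutativeRing c ℓ₁
  commutativeRing = record { isCommutativeRing = isCommutativeRing }

  infix 4 _<_
  field
    _<_                  : Rel Carrier ℓ₃
    isStrictPartialOrder : IsStrictPartialOrder _≈_ _<_
    #⇒<⊎>                : ∀ {x y} → x # y → x < y ⊎ y < x
    <⇒#                  : ∀ {x y} → x < y → x # y
    +-monoʳ-<            : ∀ z {x y} → x < y → z + x < z + y
    *-pos                : ∀ {x y} → 0# < x → 0# < y → 0# < x * y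

  infix 4 _≤_
  _≤_ : Rel Carrier ℓ₃
  x ≤ y = ¬ (y < x)

  infixl 7 _/_[_]
  _/_[_] : (x y : Carrier) → y # 0# → Carrier
  x / y [ y#0 ] = x * proj₁ (#⇒invertible y#0)

  2# : Carrier
  2# = 1# + 1#

  private
    module < = IsStrictPartialOrder isStrictPartialOrder
    open HeytingProperties heytingCommutativeRing using (1#0; x-0≈x; invertibleˡ⇒#)
    open RingProperties (CommutativeRing.ring commutativeRing) using (-‿distribˡ-*; -‿involutive)

    <-cong : ∀ {x x′ y y′} → x ≈ x′ → y ≈ y′ → x < y → x′ < y′
    <-cong x≈x′ y≈y′ = <.<-respˡ-≈ x≈x′ ∘ <.<-respʳ-≈ y≈y′

    <-asym : ∀ {x y} → x < y → ¬ (y < x)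
    <-asym x<y y<x = <.irrefl ≈-refl (<.trans x<y y<x)

    0<1 : 0# < 1#
    0<1 = [ (λ 1<0 → contradiction (square (negate 1<0)) (<-asym 1<0)) , (λ 0<1 → 0<1) ]′ (#⇒<⊎> 1#0)
      where
      negate : 1# < 0# → 0# < - 1#
      negate 1<0 = <-cong (-‿inverseˡ 1#) (+-identityʳ (- 1#)) (+-monoʳ-< (- 1#) 1<0)

      square : 0# < - 1# → 0# < 1#
      square 0<-1 = <-cong ≈-refl
        (≈-trans (≈-sym (-‿distribˡ-* 1# (- 1#)))
          (≈-trans (-‿cong (*-identityˡ (- 1#))) (-‿involutive 1#)))
        (*-pos 0<-1 0<-1)

    x<x+y : ∀ x {y} → 0# < y → x < x + y
    x<x+y x 0<y = <-cong (+-identityʳ x) ≈-refl (+-monoʳ-< x 0<y)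

    x+y<x : ∀ x {y} → y < 0# → x + y < x
    x+y<x x y<0 = <-cong ≈-refl (+-identityʳ x) (+-monoʳ-< x y<0)

  2#0 : 2# # 0#
  2#0 = #-sym (<⇒# (<.trans 0<1 (x<x+y 1# 0<1)))

  ½ : Carrier
  ½ = 1# / 2# [ 2#0 ]

  private
    ½+½≈1 : ½ + ½ ≈ 1#
    ½+½≈1 = ≈-trans (+-cong (*-identityˡ h) (*-identityˡ h))
      (≈-trans (+-cong (≈-sym (*-identityʳ h)) (≈-sym (*-identityʳ h)))
      (≈-trans (≈-sym (distribˡ h 1# 1#))
      (≈-trans (*-congˡ (≈-sym (x-0≈x 2#))) (proj₁ (proj₂ (#⇒invertible 2#0))))))
      where h = proj₁ (#⇒invertible 2#0)

    ½#0 : ½ # 0#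
    ½#0 = invertibleˡ⇒# (2# , ≈-trans (*-congˡ (x-0≈x ½))
      (≈-trans (distribʳ ½ 1# 1#)
      (≈-trans (+-cong (*-identityˡ ½) (*-identityˡ ½)) ½+½≈1)))

    0<½ : 0# < ½
    0<½ = [ (λ ½<0 → contradiction (<.trans (<-cong ½+½≈1 ≈-refl (x+y<x ½ ½<0)) ½<0) (<-asym 0<1))
          , (λ 0<½ → 0<½) ]′ (#⇒<⊎> ½#0)

    ½<1 : ½ < 1#
    ½<1 = <-cong ≈-refl ½+½≈1 (x<x+y ½ 0<½)

    x≤½⇒x<1 : ∀ {x} → x ≤ ½ → x < 1#
    x≤½⇒x<1 {x} x≤½ with #-cotrans (<⇒# ½<1) x
    ... | inj₁ ½#x = [ (λ ½<x → contradiction ½<x x≤½) , (λ x<½ → <.trans x<½ ½<1) ]′ (#⇒<⊎> ½#x)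
    ... | inj₂ x#1 = [ (λ x<1 → x<1) , (λ 1<x → contradiction (<.trans ½<1 1<x) x≤½) ]′ (#⇒<⊎> x#1)

  x≤½⇒1-x#0 : ∀ {x} → x ≤ ½ → 1# - x # 0#
  x≤½⇒1-x#0 {x} x≤½ with #⇒invertible (#-sym (<⇒# (x≤½⇒x<1 x≤½)))
  ... | y , y*[1-x]≈1 , _ = invertibleˡ⇒# (y , ≈-trans (*-congˡ (x-0≈x (1# - x))) y*[1-x]≈1)

------------------------------------------------------------------------
-- Graphs

-- An undirected edge is stored as the pair of its endpoints in increasing
-- order, which rules out loops; injectivity rules out parallel edges.

record Graph : Set where
  field
    #V        : ℕ
    #E        : ℕ
    ends      : Fin #E → Fin #V × Fin #V
    ordered   : ∀ e → proj₁ (ends e) Fin.< proj₂ (ends e)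
    injective : Injective _≡_ _≡_ ends

  V = Fin #V
  E = Fin #E

module Connectivity {n : ℕ} where

  Adjacent : ∀ {m} → (Fin m → Fin n × Fin n) → Subset m → Rel (Fin n) _
  Adjacent ends S u v = ∃ λ e → e ∈ S × (ends e ≡ (u , v) ⊎ ends e ≡ (v , u))

  Connected : ∀ {m} → (Fin m → Fin n × Fin n) → Subset m → Rel (Fin n) _
  Connected ends S = Star (Adjacent ends S)

  private
    weaken : ∀ {m} {ends : Fin (ℕ.suc m) → Fin n × Fin n} {s S u v} →
             Connected (ends ∘ Fin.suc) S u v → Connected ends (s ∷ S) u v
    weaken = starMap (λ x → x) λ (e , e∈S , eq) → Fin.suc e , there e∈S , eq

    -- A walk in s ∷ S either avoids edge zero, with ends (a , b), or reduces
    -- to one that uses it exactly once, in one of the two directions.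
    Split : ∀ {m} → (Fin (ℕ.suc m) → Fin n × Fin n) → Subset m → Rel (Fin n) _
    Split ends S u v = let a , b = ends Fin.zero; _~_ = Connected (ends ∘ Fin.suc) S in
      u ~ v ⊎ (u ~ a × b ~ v) ⊎ (u ~ b × a ~ v)

    split : ∀ {m} (ends : Fin (ℕ.suc m) → Fin n × Fin n) {S u v} →
            Connected ends (inside ∷ S) u v → Split ends S u v
    split ends ε = inj₁ ε
    split ends ((Fin.suc e , there e∈S , eq) ◅ w) with split ends w
    ... | inj₁ x              = inj₁ ((e , e∈S , eq) ◅ x)
    ... | inj₂ (inj₁ (x , y)) = inj₂ (inj₁ ((e , e∈S , eq) ◅ x , y))
    ... | inj₂ (inj₂ (x , y)) = inj₂ (inj₂ ((e , e∈S , eq) ◅ x , y))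
    split ends ((Fin.zero , here , eq) ◅ w) with ends Fin.zero | eq | split ends w
    ... | _ | inj₁ refl | inj₁ x              = inj₂ (inj₁ (ε , x))
    ... | _ | inj₁ refl | inj₂ (inj₁ (_ , y)) = inj₂ (inj₁ (ε , y))
    ... | _ | inj₁ refl | inj₂ (inj₂ (_ , y)) = inj₁ y
    ... | _ | inj₂ refl | inj₁ x              = inj₂ (inj₂ (ε , x))
    ... | _ | inj₂ refl | inj₂ (inj₁ (_ , y)) = inj₁ y
    ... | _ | inj₂ refl | inj₂ (inj₂ (_ , y)) = inj₂ (inj₂ (ε , y))

    unsplit : ∀ {m} (ends : Fin (ℕ.suc m) → Fin n × Fin n) {S u v} →
              Split ends S u v → Connected ends (inside ∷ S) u v
    unsplit ends (inj₁ x)              = weaken x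
    unsplit ends (inj₂ (inj₁ (x , y))) = weaken x ◅◅ (Fin.zero , here , inj₁ refl) ◅ weaken y
    unsplit ends (inj₂ (inj₂ (x , y))) = weaken x ◅◅ (Fin.zero , here , inj₂ refl) ◅ weaken y

  connected? : ∀ {m} (ends : Fin m → Fin n × Fin n) (S : Subset m) → Decidable (Connected ends S)
  connected? ends []            u v =
    map′ (λ { refl → ε }) (λ { ε → refl ; ((() , _) ◅ _) }) (u Fin.≟ v)
  connected? ends (outside ∷ S) u v =
    map′ weaken (starMap (λ x → x) λ { (Fin.suc e , there e∈S , eq) → e , e∈S , eq })
      (connected? (ends ∘ Fin.suc) S u v)
  connected? ends (inside ∷ S)  u v =
    map′ (unsplit ends) (split ends)
      (u ~? v ⊎-dec (u ~? a ×-dec b ~? v) ⊎-dec (u ~? b ×-dec a ~? v))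
    where
    _~?_ = connected? (ends ∘ Fin.suc) S
    a = proj₁ (ends Fin.zero)
    b = proj₂ (ends Fin.zero)

------------------------------------------------------------------------
-- Random edge sets

_≟ₛ_ : ∀ {n} → DecidableEquality (Subset n)
_≟ₛ_ = ≡-dec Bool._≟_

module Model {c ℓ₁ ℓ₂ ℓ₃} (F : OrderedField c ℓ₁ ℓ₂ ℓ₃) (G : Graph) where

  open OrderedField F
  open Graph G public
  open Connectivity

  EdgeSet VertexSet : Set
  EdgeSet   = Subset #E
  VertexSet = Subset #V

  open CommutativeMonoidSum (CommutativeRing.*-commutativeMonoid commutativeRing)
    using () renaming (sum to ∏)

  ∏∈ : ∀ {n} → Subset n → (Fin n → Carrier) → Carrier
  ∏∈ A f = ∏ λ i → if lookup A i then f i else 1#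

  ∑Subsets : ∀ {n} → (Subset n → Carrier) → Carrier
  ∑Subsets {ℕ.zero}  f = f []
  ∑Subsets {ℕ.suc n} f = ∑Subsets (f ∘ (outside ∷_)) + ∑Subsets (f ∘ (inside ∷_))

  incident : V → EdgeSet
  incident v = tabulate λ e → does (v Fin.≟ proj₁ (ends e)) ∨ does (v Fin.≟ proj₂ (ends e))

  degree : EdgeSet → V → ℕ
  degree S v = ∣ S ∩ incident v ∣

  odd : EdgeSet → VertexSet
  odd S = tabulate λ v → degree S v % 2 ≡ᵇ 1

  component : EdgeSet → V → VertexSet
  component S v = tabulate λ u → does (connected? ends S v u)

  -- Duplicate-free list of the components.
  κ : EdgeSet → List VertexSet
  κ S = deduplicate _≟ₛ_ (map (component S) (allFin #V))

  -- Probability that the edge set is S when every edge e is present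
  -- independently with probability r e.
  bernoulli : (E → Carrier) → EdgeSet → Carrier
  bernoulli r S = ∏∈ S r * ∏∈ (∁ S) (λ f → 1# - r f)

  sgWeight : (p : E → Carrier) (η : V → Carrier) → EdgeSet → Carrier
  sgWeight p η S = ∏∈ S p * ∏∈ (∁ S) (λ f → 1# - p f) * ∏∈ (odd S) η

  wrcWeight : (q : E → Carrier) (ƛ : V → Carrier) → EdgeSet → Carrier
  wrcWeight q ƛ S = ∏∈ S q * ∏∈ (∁ S) (λ f → 1# - q f)
                  * foldr _*_ 1# (map (λ C → 1# + ∏∈ C ƛ) (κ S))

  infix 4 _follows_

  -- π is a probability distribution with π S ∝ w S. Since the total mass is
  -- one, the constant is forced to be the inverse of the sum of all weights.
  record _follows_ (π w : EdgeSet → Carrier) : Set (c ⊔ ℓ₁ ⊔ ℓ₃) where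
    field
      nonneg       : ∀ S → 0# ≤ π S
      total        : ∑Subsets π ≈ 1#
      constant     : Carrier
      proportional : ∀ S → π S ≈ constant * w S

  -- Law of S ∪ T, where S has law π and T is an independent edge set that
  -- contains each edge e independently with probability r e. The coins of
  -- edges already in S have no effect.
  addEdges : (r : E → Carrier) (π : EdgeSet → Carrier) → EdgeSet → Carrier
  addEdges r π R = ∑Subsets λ S → ∑Subsets λ T →
    if does ((S ∪ T) ≟ₛ R) then π S * bernoulli r T else 0#

{-# OPTIONS --safe #-}
module Submission where

-- An edge e ends up in R with weight p e, whether it comes from S or is added
-- with probability p e / (1 - p e), and stays out with weight 1 - 2 p e. So R
-- has weight ∏_{e ∈ R} p e ∏_{e ∉ R} (1 - 2 p e) times the sum over S ⊆ R of
-- ∏_{v ∈ odd S} η v. After multiplication by ∏_v (1 + ƛ v) the summand becomes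
-- ∏_v (1 ± ƛ v), with the sign of the parity of v in S. Expand it over vertex
-- sets A: the sign of the term of A is -1 to the number of edges of S that
-- leave A. Summing over S ⊆ R first, a set A contributes 2^|R| ∏_{v ∈ A} ƛ v
-- if it is a union of components of R, and 0 otherwise, and the sum over the
-- unions of components factors over the components.

open import Algebra.Bundles using (CommutativeRing)
import Algebra.Apartness.Properties.HeytingCommutativeRing as HeytingProperties
import Algebra.Properties.CommutativeMonoid.Sum as CommutativeMonoidSum
import Algebra.Properties.CommutativeSemigroup as CommutativeSemigroupProperties
import Algebra.Properties.Ring as RingProperties
import Algebra.Solver.CommutativeMonoid as CommutativeMonoidSolver
open import Data.Bool.Base using (Bool; true; false; if_then_else_; _∨_; _∧_; _xor_; not)
import Data.Bool.Properties as Bool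
open import Data.Fin.Base as Fin using (Fin)
import Data.Fin.Properties as Fin
open import Data.Fin.Subset using (Subset; inside; outside; _∪_; _∩_; ∁; ∣_∣; ⊥)
open import Data.List.Base using (List; foldr; map; allFin; []; _∷_)
import Data.List.Membership.DecPropositional as DecMembership
open import Data.List.Membership.Propositional using () renaming (_∈_ to _∈ₗ_; _∉_ to _∉ₗ_)
open import Data.List.Membership.Propositional.Properties
  using (∈-deduplicate⁺; ∈-deduplicate⁻; ∈-map⁺; ∈-map⁻; ∈-allFin)
open import Data.List.Relation.Unary.All as All using (All; []; _∷_)
import Data.List.Relation.Unary.All.Properties as All
open import Data.List.Relation.Unary.AllPairs using ([]; _∷_)
open import Data.List.Relation.Unary.Any using (here; there)
open import Data.List.Relation.Unary.Unique.DecPropositional.Properties using (deduplicate-!)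
open import Data.List.Relation.Unary.Unique.Propositional using (Unique)
open import Data.Nat.Base using (ℕ; zero; suc; _%_; _≡ᵇ_)
open import Data.Product.Base using (_×_; _,_; proj₁; proj₂; ∃)
open import Data.Sum.Base using (inj₁; inj₂)
open import Data.Vec.Base using ([]; _∷_; lookup; tabulate; zipWith)
import Data.Vec.Properties as Vec
open import Function.Base using (_∘_)
open import Function.Bundles using (_⇔_; mk⇔)
open import Relation.Binary.Construct.Closure.ReflexiveTransitive using (ε; _◅_; _◅◅_; reverse)
open import Relation.Binary.Core using (Rel)
open import Relation.Binary.Definitions using (Decidable)
open import Relation.Binary.PropositionalEquality.Core as ≡ using (_≡_)
import Relation.Binary.Reasoning.Setoid as SetoidReasoning
open import Relation.Binary.Structures using (IsStrictPartialOrder; IsEquivalence)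
open import Relation.Nullary.Decidable
  using (Dec; yes; no; does; dec-true; dec-false; does-⇔; _×-dec_; _→-dec_)
open import Relation.Nullary.Negation using (¬_; contradiction)

open import Defs

-- Order and arithmetic in an ordered field without decidable order.

module OrderedFieldProperties {c ℓ₁ ℓ₂ ℓ₃} (F : OrderedField c ℓ₁ ℓ₂ ℓ₃) where

  open OrderedField F
  open CommutativeRing commutativeRing using (ring; *-commutativeSemigroup)
  open CommutativeSemigroupProperties *-commutativeSemigroup using (x∙yz≈xz∙y; x∙yz≈y∙xz)
  open HeytingProperties heytingCommutativeRing using (invertibleˡ⇒#; x-0≈x)
  open RingProperties ring using (-‿distribˡ-*; -‿distribʳ-*; -‿involutive; -‿+-comm)
  open SetoidReasoning setoid
  private module < = IsStrictPartialOrder isStrictPartialOrder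

  private variable
    x y : Carrier

  recip : x # 0# → Carrier
  recip x#0 = proj₁ (#⇒invertible x#0)

  recip-inverseˡ : (x#0 : x # 0#) → recip x#0 * x ≈ 1#
  recip-inverseˡ {x} x#0 =
    ≈-trans (*-congˡ (≈-sym (x-0≈x x))) (proj₁ (proj₂ (#⇒invertible x#0)))

  recip-inverseʳ : (x#0 : x # 0#) → x * recip x#0 ≈ 1#
  recip-inverseʳ x#0 = ≈-trans (*-comm _ _) (recip-inverseˡ x#0)

  xy#0⇒x#0 : x * y # 0# → x # 0#
  xy#0⇒x#0 {x} {y} xy#0 = invertibleˡ⇒# (recip xy#0 * y , (begin
    recip xy#0 * y * (x - 0#)  ≈⟨ *-congˡ (x-0≈x x) ⟩
    recip xy#0 * y * x         ≈⟨ x∙yz≈xz∙y _ _ _ ⟨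
    recip xy#0 * (x * y)       ≈⟨ recip-inverseˡ xy#0 ⟩
    1#                         ∎))

  ≤-respʳ : x ≈ y → 0# ≤ x → 0# ≤ y
  ≤-respʳ x≈y 0≤x y<0 = 0≤x (<.<-respˡ-≈ (≈-sym x≈y) y<0)

  0≤x∧x#0⇒0<x : 0# ≤ x → x # 0# → 0# < x
  0≤x∧x#0⇒0<x 0≤x x#0 with #⇒<⊎> x#0
  ... | inj₁ x<0 = contradiction x<0 0≤x
  ... | inj₂ 0<x = 0<x

  -- As `≤` is a negated strict inequality, `x * y < 0#` has to be refuted. It makes the product
  -- apart from zero, hence both factors apart from zero, hence both positive, and so is their
  -- product.
  *-nonneg : 0# ≤ x → 0# ≤ y → 0# ≤ x * y
  *-nonneg {x} {y} 0≤x 0≤y xy<0 = <.irrefl ≈-refl (<.trans xy<0 (*-pos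
    (0≤x∧x#0⇒0<x 0≤x (xy#0⇒x#0 (<⇒# xy<0)))
    (0≤x∧x#0⇒0<x 0≤y (xy#0⇒x#0 (<⇒# (<.<-respˡ-≈ (*-comm x y) xy<0))))))

  -- Cotransitivity replaces a decision on the sign of `x`. If `x + y < 0#`, either `x # 0#`, so `x`
  -- is positive and `y < x + y < 0#`, or `x + y # x`, and then one of `x`, `y` is negative.
  +-nonneg : 0# ≤ x → 0# ≤ y → 0# ≤ x + y
  +-nonneg {x} {y} 0≤x 0≤y x+y<0 with #-cotrans (<⇒# x+y<0) x
  ... | inj₂ x#0 = 0≤y (<.trans
          (<.<-respˡ-≈ (+-identityʳ y) (<.<-respʳ-≈ (+-comm y x) (+-monoʳ-< y (0≤x∧x#0⇒0<x 0≤x x#0))))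
          x+y<0)
  ... | inj₁ x+y#x with #⇒<⊎> x+y#x
  ...   | inj₂ x<x+y = 0≤x (<.trans x<x+y x+y<0)
  ...   | inj₁ x+y<x = 0≤y (<.<-respˡ-≈ cancel (<.<-respʳ-≈ (-‿inverseˡ x) (+-monoʳ-< (- x) x+y<x)))
    where
    cancel : - x + (x + y) ≈ y
    cancel = ≈-trans (≈-sym (+-assoc _ _ _)) (≈-trans (+-congʳ (-‿inverseˡ x)) (+-identityˡ y))

  x<0⇒0<-x : x < 0# → 0# < - x
  x<0⇒0<-x {x} x<0 = <.<-respˡ-≈ (-‿inverseˡ x) (<.<-respʳ-≈ (+-identityʳ (- x)) (+-monoʳ-< (- x) x<0))

  <⇒≤ : x < y → x ≤ y
  <⇒≤ x<y y<x = <.irrefl ≈-refl (<.trans x<y y<x)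

  -- If 1/x were negative, then (1/x)² x = 1/x would be nonnegative.
  recip-nonneg : (x#0 : x # 0#) → 0# ≤ x → 0# ≤ recip x#0
  recip-nonneg {x} x#0 0≤x x⁻¹<0 = ≤-respʳ (begin
    - x⁻¹ * - x⁻¹ * x     ≈⟨ *-congʳ (-‿distribˡ-* _ _) ⟨
    - (x⁻¹ * - x⁻¹) * x   ≈⟨ *-congʳ (-‿cong (-‿distribʳ-* _ _)) ⟨
    - - (x⁻¹ * x⁻¹) * x   ≈⟨ *-congʳ (-‿involutive _) ⟩
    x⁻¹ * x⁻¹ * x         ≈⟨ *-assoc _ _ _ ⟩
    x⁻¹ * (x⁻¹ * x)       ≈⟨ *-congˡ (recip-inverseˡ x#0) ⟩
    x⁻¹ * 1#              ≈⟨ *-identityʳ _ ⟩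
    x⁻¹                   ∎)
    (*-nonneg (<⇒≤ (*-pos 0<-x⁻¹ 0<-x⁻¹)) 0≤x) x⁻¹<0
    where
    x⁻¹ = recip x#0
    0<-x⁻¹ = x<0⇒0<-x x⁻¹<0

  2*x≈x+x : ∀ x → 2# * x ≈ x + x
  2*x≈x+x x = ≈-trans (distribʳ x 1# 1#) (+-cong (*-identityˡ x) (*-identityˡ x))

  ½+½≈1 : ½ + ½ ≈ 1#
  ½+½≈1 = begin
    ½ + ½             ≈⟨ 2*x≈x+x ½ ⟨
    2# * ½            ≈⟨ *-congˡ (*-identityˡ _) ⟩
    2# * recip 2#0    ≈⟨ recip-inverseʳ 2#0 ⟩
    1#                ∎

  x≤½⇒0≤½-x : x ≤ ½ → 0# ≤ ½ - x
  x≤½⇒0≤½-x {x} x≤½ ½-x<0 = x≤½ (<.<-respˡ-≈ (begin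
    x + (½ - x)   ≈⟨ +-congˡ (+-comm _ _) ⟩
    x + (- x + ½) ≈⟨ +-assoc _ _ _ ⟨
    x - x + ½     ≈⟨ +-congʳ (-‿inverseʳ x) ⟩
    0# + ½        ≈⟨ +-identityˡ ½ ⟩
    ½             ∎) (<.<-respʳ-≈ (+-identityʳ x) (+-monoʳ-< x ½-x<0)))

  +-interchange : ∀ a b c d → (a + b) + (c + d) ≈ (a + c) + (b + d)
  +-interchange = CommutativeSemigroupProperties.interchange
    (CommutativeRing.+-commutativeSemigroup commutativeRing)

  1-2x≈1-x-x : ∀ x → 1# - 2# * x ≈ 1# - x - x
  1-2x≈1-x-x x = begin
    1# - 2# * x       ≈⟨ +-congˡ (-‿cong (2*x≈x+x x)) ⟩
    1# - (x + x)      ≈⟨ +-congˡ (-‿+-comm x x) ⟨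
    1# + (- x + - x)  ≈⟨ +-assoc _ _ _ ⟨
    1# - x - x        ∎

  module _ (x≤½ : x ≤ ½) where

    0≤1-2x : 0# ≤ 1# - 2# * x
    0≤1-2x = ≤-respʳ (begin
      (½ - x) + (½ - x)     ≈⟨ +-interchange _ _ _ _ ⟩
      (½ + ½) + (- x + - x) ≈⟨ +-cong ½+½≈1 (-‿+-comm x x) ⟩
      1# - (x + x)          ≈⟨ +-congˡ (-‿cong (2*x≈x+x x)) ⟨
      1# - 2# * x           ∎) (+-nonneg (x≤½⇒0≤½-x x≤½) (x≤½⇒0≤½-x x≤½))

    0≤1-x : 0# ≤ x → 0# ≤ 1# - x
    0≤1-x 0≤x = ≤-respʳ (begin
      1# - 2# * x + x       ≈⟨ +-congʳ (1-2x≈1-x-x x) ⟩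
      1# - x - x + x        ≈⟨ +-assoc _ _ _ ⟩
      1# - x + (- x + x)    ≈⟨ +-congˡ (-‿inverseˡ x) ⟩
      1# - x + 0#           ≈⟨ +-identityʳ _ ⟩
      1# - x                ∎) (+-nonneg 0≤1-2x 0≤x)

    odds : Carrier
    odds = x / (1# - x) [ x≤½⇒1-x#0 x≤½ ]

    -- The weight of an edge that is missing at first and then added; it agrees with that of an edge
    -- present from the start.
    [1-x]*odds≈x : (1# - x) * odds ≈ x
    [1-x]*odds≈x = begin
      (1# - x) * (x * recip 1-x#0)  ≈⟨ x∙yz≈y∙xz _ _ _ ⟩
      x * ((1# - x) * recip 1-x#0)  ≈⟨ *-congˡ (recip-inverseʳ 1-x#0) ⟩
      x * 1#                        ≈⟨ *-identityʳ x ⟩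
      x                             ∎
      where 1-x#0 = x≤½⇒1-x#0 x≤½

    -- The weight of an edge that is missing at first and stays missing.
    [1-x]*[1-odds]≈1-2x : (1# - x) * (1# - odds) ≈ 1# - 2# * x
    [1-x]*[1-odds]≈1-2x = begin
      (1# - x) * (1# - odds)                ≈⟨ distribˡ _ _ _ ⟩
      (1# - x) * 1# + (1# - x) * - odds     ≈⟨ +-cong (*-identityʳ _) (≈-sym (-‿distribʳ-* _ _)) ⟩
      1# - x - (1# - x) * odds              ≈⟨ +-congˡ (-‿cong [1-x]*odds≈x) ⟩
      1# - x - x                            ≈⟨ 1-2x≈1-x-x x ⟨
      1# - 2# * x                           ∎

    odds-nonneg : 0# ≤ x → 0# ≤ odds
    odds-nonneg 0≤x = *-nonneg 0≤x (recip-nonneg _ (0≤1-x 0≤x))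

    -- The value is `(1 - 2x) / (1 - x)`, whose numerator is nonnegative by the bound `x ≤ ½`.
    1-odds-nonneg : 0# ≤ x → 0# ≤ 1# - odds
    1-odds-nonneg 0≤x = ≤-respʳ (begin
      recip 1-x#0 * (1# - 2# * x)               ≈⟨ *-congˡ [1-x]*[1-odds]≈1-2x ⟨
      recip 1-x#0 * ((1# - x) * (1# - odds))    ≈⟨ *-assoc _ _ _ ⟨
      recip 1-x#0 * (1# - x) * (1# - odds)      ≈⟨ *-congʳ (recip-inverseˡ 1-x#0) ⟩
      1# * (1# - odds)                          ≈⟨ *-identityˡ _ ⟩
      1# - odds                                 ∎)
      (*-nonneg (recip-nonneg _ (0≤1-x 0≤x)) 0≤1-2x)
      where 1-x#0 = x≤½⇒1-x#0 x≤½

  0≤1 : 0# ≤ 1#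
  0≤1 1<0 = <.irrefl ≈-refl (<.trans 1<0 (<.<-respʳ-≈ (begin
    - 1# * - 1#       ≈⟨ -‿distribˡ-* _ _ ⟨
    - (1# * - 1#)     ≈⟨ -‿cong (*-identityˡ _) ⟩
    - - 1#            ≈⟨ -‿involutive 1# ⟩
    1#                ∎) (*-pos (x<0⇒0<-x 1<0) (x<0⇒0<-x 1<0))))

-- Finite subsets, and sums and products over them.

lookup-injective : ∀ {n} {A B : Subset n} → (∀ i → lookup A i ≡ lookup B i) → A ≡ B
lookup-injective {A = A} {B} eq = ≡.trans (≡.sym (Vec.tabulate∘lookup A))
  (≡.trans (Vec.tabulate-cong eq) (Vec.tabulate∘lookup B))

infixl 6 _△_
-- Symmetric difference: for fixed `C`, the map `A ↦ A △ C` is a bijection on all subsets, so sums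
-- can be reindexed along it.
_△_ : ∀ {n} → Subset n → Subset n → Subset n
_△_ = zipWith _xor_

module SubsetSums {c ℓ₁ ℓ₂ ℓ₃} (F : OrderedField c ℓ₁ ℓ₂ ℓ₃) (G : Graph) where

  open OrderedField F
  open Model F G
  open OrderedFieldProperties F
  open SetoidReasoning setoid
  open CommutativeMonoidSum (CommutativeRing.*-commutativeMonoid commutativeRing) public
    using () renaming
    ( sum to ∏; sum-cong-≋ to ∏-cong; ∑-distrib-+ to ∏-distrib-*
    ; ∑-comm to ∏-comm; sum-replicate-zero to ∏-replicate-1 )

  private variable
    n : ℕ
    x y : Carrier

  if-≈ : ∀ b {x x′ y y′} → x ≈ x′ → y ≈ y′ → (if b then x else y) ≈ (if b then x′ else y′)
  if-≈ true  x≈x′ _ = x≈x′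
  if-≈ false _ y≈y′ = y≈y′

  if-does-cong : ∀ {p} {P : Set p} (P? : Dec P) {x y z} → (P → x ≈ y) →
                 (if does P? then x else z) ≈ (if does P? then y else z)
  if-does-cong (yes p) x≈y = x≈y p
  if-does-cong (no _)  x≈y = ≈-refl

  *-if : ∀ b x y → x * (if b then y else 0#) ≈ (if b then x * y else 0#)
  *-if true  x y = ≈-refl
  *-if false x y = zeroʳ x

  if-const : ∀ b → x ≈ y → (if b then x else y) ≈ y
  if-const true  x≈y = x≈y
  if-const false _   = ≈-refl

  -- The Iverson bracket, which turns a decided condition into a factor.
  ⟦_⟧ : Bool → Carrier
  ⟦ b ⟧ = if b then 1# else 0#

  if≈*⟦⟧ : ∀ b x → (if b then x else 0#) ≈ x * ⟦ b ⟧
  if≈*⟦⟧ true  x = ≈-sym (*-identityʳ x)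
  if≈*⟦⟧ false x = ≈-sym (zeroʳ x)

  ∏-≈1 : (f : Fin n → Carrier) → (∀ i → f i ≈ 1#) → ∏ f ≈ 1#
  ∏-≈1 {n} f f≈1 = ≈-trans (∏-cong f≈1) (∏-replicate-1 n)

  ∏-≈0 : (f : Fin n → Carrier) (i : Fin n) → f i ≈ 0# → ∏ f ≈ 0#
  ∏-≈0 f Fin.zero    f₀≈0 = ≈-trans (*-congʳ f₀≈0) (zeroˡ _)
  ∏-≈0 f (Fin.suc i) fᵢ≈0 = ≈-trans (*-congˡ (∏-≈0 (f ∘ Fin.suc) i fᵢ≈0)) (zeroʳ _)

  ∏-nonneg : (f : Fin n → Carrier) → (∀ i → 0# ≤ f i) → 0# ≤ ∏ f
  ∏-nonneg {zero}  f 0≤f = 0≤1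
  ∏-nonneg {suc n} f 0≤f = *-nonneg (0≤f Fin.zero) (∏-nonneg (f ∘ Fin.suc) (0≤f ∘ Fin.suc))

  ∏-point : ∀ {n} (g : Fin n → Carrier) (a : Fin n) →
            ∏ (λ v → if does (v Fin.≟ a) then g v else 1#) ≈ g a
  ∏-point {suc n} g Fin.zero    = ≈-trans (*-congˡ (∏-≈1 {n} _ λ _ → ≈-refl)) (*-identityʳ _)
  ∏-point g (Fin.suc a) = ≈-trans (*-identityˡ _) (∏-point (g ∘ Fin.suc) a)

  -- If `Q` fails, a search through the finite index set finds some `i` for which `P i` fails, and
  -- its factor zero kills the product.
  ∏-⟦⟧ : ∀ {p q} {P : Fin n → Set p} {Q : Set q} (P? : ∀ i → Dec (P i)) (Q? : Dec Q) →
         (Q → ∀ i → P i) → ((∀ i → P i) → Q) → ∏ (λ i → ⟦ does (P? i) ⟧) ≈ ⟦ does Q? ⟧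
  ∏-⟦⟧ P? (yes q) Q⇒P _ = ∏-≈1 _ λ i → reflexive (≡.cong ⟦_⟧ (dec-true (P? i) (Q⇒P q i)))
  ∏-⟦⟧ P? (no ¬q) _ P⇒Q with Fin.¬∀⟶∃¬ _ _ P? (¬q ∘ P⇒Q)
  ... | i , ¬Pi = ∏-≈0 _ i (reflexive (≡.cong ⟦_⟧ (dec-false (P? i) ¬Pi)))

  -- Brings a weight into the form of a product over all indices of a function of the state, to
  -- which `∑-∏` applies.
  ∏∈-∏∈∁ : (A : Subset n) (f g : Fin n → Carrier) →
           ∏∈ A f * ∏∈ (∁ A) g ≈ ∏ (λ i → if lookup A i then f i else g i)
  ∏∈-∏∈∁ {n} A f g = ≈-trans (≈-sym (∏-distrib-* {n} _ _)) (∏-cong pointwise)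
    where
    pointwise : ∀ i → (if lookup A i then f i else 1#) * (if lookup (∁ A) i then g i else 1#)
                      ≈ (if lookup A i then f i else g i)
    pointwise i rewrite Vec.lookup-map i not A with lookup A i
    ... | true  = *-identityʳ (f i)
    ... | false = *-identityˡ (g i)

  ∑-cong : {f g : Subset n → Carrier} → (∀ A → f A ≈ g A) → ∑Subsets f ≈ ∑Subsets g
  ∑-cong {zero}  f≈g = f≈g []
  ∑-cong {suc n} f≈g = +-cong (∑-cong (f≈g ∘ (outside ∷_))) (∑-cong (f≈g ∘ (inside ∷_)))

  ∑-nonneg : (f : Subset n → Carrier) → (∀ A → 0# ≤ f A) → 0# ≤ ∑Subsets f
  ∑-nonneg {zero}  f 0≤f = 0≤f []
  ∑-nonneg {suc n} f 0≤f = +-nonneg (∑-nonneg _ (0≤f ∘ (outside ∷_))) (∑-nonneg _ (0≤f ∘ (inside ∷_)))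

  ∑-distrib-+ : (f g : Subset n → Carrier) → ∑Subsets (λ A → f A + g A) ≈ ∑Subsets f + ∑Subsets g
  ∑-distrib-+ {zero}  f g = ≈-refl
  ∑-distrib-+ {suc n} f g = ≈-trans
    (+-cong (∑-distrib-+ (f ∘ (outside ∷_)) (g ∘ (outside ∷_))) (∑-distrib-+ (f ∘ (inside ∷_)) (g ∘ (inside ∷_))))
    (+-interchange _ _ _ _)

  *-distribˡ-∑ : ∀ x (f : Subset n → Carrier) → ∑Subsets (λ A → x * f A) ≈ x * ∑Subsets f
  *-distribˡ-∑ {zero}  x f = ≈-refl
  *-distribˡ-∑ {suc n} x f = ≈-trans
    (+-cong (*-distribˡ-∑ x (f ∘ (outside ∷_))) (*-distribˡ-∑ x (f ∘ (inside ∷_)))) (≈-sym (distribˡ x _ _))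

  ∑-comm : ∀ {m} (f : Subset m → Subset n → Carrier) →
           ∑Subsets (λ A → ∑Subsets λ B → f A B) ≈ ∑Subsets (λ B → ∑Subsets λ A → f A B)
  ∑-comm         {m = zero}  f = ≈-refl
  ∑-comm {n = n} {m = suc m} f = ≈-trans
    (+-cong (∑-comm (f ∘ (outside ∷_))) (∑-comm (f ∘ (inside ∷_)))) (≈-sym (∑-distrib-+ {n} _ _))

  -- Expanding a product of binomials means choosing one term for every index, and the choices are
  -- the subsets.
  ∑-∏ : (h : Fin n → Bool → Carrier) →
        ∑Subsets (λ A → ∏ λ i → h i (lookup A i)) ≈ ∏ (λ i → h i false + h i true)
  ∑-∏ {zero}  h = ≈-refl
  ∑-∏ {suc n} h = begin
    ∑Subsets (λ A → h₀ false * rest A) + ∑Subsets (λ A → h₀ true * rest A)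
      ≈⟨ +-cong (*-distribˡ-∑ _ rest) (*-distribˡ-∑ _ rest) ⟩
    h₀ false * ∑Subsets rest + h₀ true * ∑Subsets rest
      ≈⟨ distribʳ _ _ _ ⟨
    (h₀ false + h₀ true) * ∑Subsets rest
      ≈⟨ *-congˡ (∑-∏ (h ∘ Fin.suc)) ⟩
    (h₀ false + h₀ true) * ∏ (λ i → h (Fin.suc i) false + h (Fin.suc i) true) ∎
    where
    h₀ = h Fin.zero
    rest = λ A → ∏ λ i → h (Fin.suc i) (lookup A i)

  -- Equality is coordinatewise, so its indicator factors and can be summed by `∑-∏`.
  ⟦≟⟧≈∏ : (A B : Subset n) → ⟦ does (A ≟ₛ B) ⟧ ≈ ∏ (λ i → ⟦ does (lookup A i Bool.≟ lookup B i) ⟧)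
  ⟦≟⟧≈∏ A B = ≈-sym (∏-⟦⟧ (λ i → lookup A i Bool.≟ lookup B i) (A ≟ₛ B)
    (λ { ≡.refl i → ≡.refl }) (λ eq → lookup-injective eq))

  -- On the surviving term `f B` may be replaced by the constant `f A`. The indicator then sums to a
  -- product with one factor per coordinate, each of them `0# + 1#` or `1# + 0#`.
  ∑-point : (A : Subset n) (f : Subset n → Carrier) →
            ∑Subsets (λ B → if does (A ≟ₛ B) then f B else 0#) ≈ f A
  ∑-point {n} A f = begin
    ∑Subsets (λ B → if does (A ≟ₛ B) then f B else 0#)
      ≈⟨ ∑-cong at-A ⟩
    ∑Subsets (λ B → f A * ∏ (λ i → ⟦ does (lookup A i Bool.≟ lookup B i) ⟧))
      ≈⟨ *-distribˡ-∑ {n} (f A) _ ⟩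
    f A * ∑Subsets (λ B → ∏ (λ i → ⟦ does (lookup A i Bool.≟ lookup B i) ⟧))
      ≈⟨ *-congˡ (∑-∏ (λ i b → ⟦ does (lookup A i Bool.≟ b) ⟧)) ⟩
    f A * ∏ (λ i → ⟦ does (lookup A i Bool.≟ false) ⟧ + ⟦ does (lookup A i Bool.≟ true) ⟧)
      ≈⟨ *-congˡ (∏-≈1 _ λ i → one (lookup A i)) ⟩
    f A * 1#
      ≈⟨ *-identityʳ _ ⟩
    f A ∎
    where
    at-A : ∀ B → (if does (A ≟ₛ B) then f B else 0#) ≈ f A * ∏ (λ i → ⟦ does (lookup A i Bool.≟ lookup B i) ⟧)
    at-A B = ≈-trans (if-does-cong (A ≟ₛ B) λ { ≡.refl → ≈-refl })
      (≈-trans (if≈*⟦⟧ (does (A ≟ₛ B)) (f A)) (*-congˡ (⟦≟⟧≈∏ A B)))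

    one : ∀ b → ⟦ does (b Bool.≟ false) ⟧ + ⟦ does (b Bool.≟ true) ⟧ ≈ 1#
    one true  = +-identityˡ 1#
    one false = +-identityʳ 1#

  -- Toggling one element swaps the two halves of the sum.
  ∑-△ : (C : Subset n) (f : Subset n → Carrier) → ∑Subsets (λ A → f (A △ C)) ≈ ∑Subsets f
  ∑-△ []            f = ≈-refl
  ∑-△ (outside ∷ C) f = +-cong (∑-△ C (f ∘ (outside ∷_))) (∑-△ C (f ∘ (inside ∷_)))
  ∑-△ (inside ∷ C)  f = ≈-trans
    (+-cong (∑-△ C (f ∘ (inside ∷_))) (∑-△ C (f ∘ (outside ∷_)))) (+-comm _ _)

  ∏∈-△ : (A C : Subset n) (f : Fin n → Carrier) →
         (∀ i → lookup A i ≡ true → lookup C i ≡ false) → ∏∈ (A △ C) f ≈ ∏∈ A f * ∏∈ C f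
  ∏∈-△ {n} A C f disjoint = ≈-trans (∏-cong pointwise) (∏-distrib-* {n} _ _)
    where
    pointwise : ∀ i → (if lookup (A △ C) i then f i else 1#)
                      ≈ (if lookup A i then f i else 1#) * (if lookup C i then f i else 1#)
    pointwise i rewrite Vec.lookup-zipWith _xor_ i A C with lookup A i | lookup C i | disjoint i
    ... | true  | false | _ = ≈-sym (*-identityʳ _)
    ... | false | true  | _ = ≈-sym (*-identityˡ _)
    ... | false | false | _ = ≈-sym (*-identityˡ _)
    ... | true  | true  | d = contradiction (d ≡.refl) λ ()

-- Unions of equivalence classes.

module Classes {n ℓ} {_~_ : Rel (Fin n) ℓ} (isEquivalence : IsEquivalence _~_) (_~?_ : Decidable _~_) where

  open DecMembership (_≟ₛ_ {n}) using () renaming (_∈?_ to _∈ₗ?_)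
  private module ~ = IsEquivalence isEquivalence

  private variable
    u v : Fin n

  -- For connectivity in `R` this unfolds to `component R`, so the entries of `κ R` are classes by
  -- definition.
  class : Fin n → Subset n
  class v = tabulate λ u → does (v ~? u)

  lookup-class : ∀ v u → lookup (class v) u ≡ does (v ~? u)
  lookup-class v u = Vec.lookup∘tabulate _ u

  ~⇒lookup-class : v ~ u → lookup (class v) u ≡ true
  ~⇒lookup-class {v} {u} v~u = ≡.trans (lookup-class v u) (dec-true (v ~? u) v~u)

  ≁⇒lookup-class : ¬ (v ~ u) → lookup (class v) u ≡ false
  ≁⇒lookup-class {v} {u} v≁u = ≡.trans (lookup-class v u) (dec-false (v ~? u) v≁u)

  class-cong : u ~ v → class u ≡ class v
  class-cong {u} {v} u~v = Vec.tabulate-cong λ w →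
    does-⇔ (mk⇔ (~.trans (~.sym u~v)) (~.trans u~v)) (u ~? w) (v ~? w)

  class-injective : class u ≡ class v → u ~ v
  class-injective {u} {v} eq with u ~? v
  ... | yes u~v = u~v
  ... | no  u≁v = contradiction
    (≡.trans (≡.sym (≁⇒lookup-class u≁v)) (≡.trans (≡.cong (λ A → lookup A v) eq) (~⇒lookup-class ~.refl)))
    λ ()

  Closed : Subset n → Set _
  Closed A = ∀ u v → u ~ v → lookup A u ≡ lookup A v

  -- For a list of classes this says that `A` is the union of some of them. No sublist is exhibited,
  -- so a finite check over the vertices decides it.
  IsUnionOf : List (Subset n) → Subset n → Set _
  IsUnionOf L A = Closed A × (∀ v → lookup A v ≡ true → class v ∈ₗ L)

  isUnionOf? : ∀ L A → Dec (IsUnionOf L A)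
  isUnionOf? L A =
    (Fin.all? λ u → Fin.all? λ v → (u ~? v) →-dec (lookup A u Bool.≟ lookup A v))
    ×-dec (Fin.all? λ v → (lookup A v Bool.≟ true) →-dec (class v ∈ₗ? L))

  class-closed : ∀ c → Closed (class c)
  class-closed c u v u~v = ≡.trans (lookup-class c u)
    (≡.trans (does-⇔ (mk⇔ (λ c~u → ~.trans c~u u~v) (λ c~v → ~.trans c~v (~.sym u~v))) (c ~? u) (c ~? v))
      (≡.sym (lookup-class c v)))

  module _ {c : Fin n} {L : List (Subset n)} (c∉L : class c ∉ₗ L) where

    -- A common vertex would have class `class c`, which would then be listed in `L`.
    isUnionOf⇒disjoint : ∀ A → IsUnionOf L A → ∀ v → lookup A v ≡ true → lookup (class c) v ≡ false
    isUnionOf⇒disjoint A (_ , A⊆L) v v∈A = ≁⇒lookup-class λ c~v →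
      c∉L (≡.subst (_∈ₗ L) (≡.sym (class-cong c~v)) (A⊆L v v∈A))

    isUnionOf⇒∌ : ∀ A → IsUnionOf L A → lookup A c ≡ false
    isUnionOf⇒∌ A A∪L with lookup A c in eq
    ... | false = ≡.refl
    ... | true  = ≡.trans (≡.sym (~⇒lookup-class ~.refl)) (isUnionOf⇒disjoint A A∪L c eq)

    private
      drop : ∀ {v} → ¬ (c ~ v) → class v ∈ₗ class c ∷ L → class v ∈ₗ L
      drop c≁v (here eq)   = contradiction (~.sym (class-injective eq)) c≁v
      drop c≁v (there v∈L) = v∈L

    isUnionOf-∌ : ∀ A → (lookup A c ≡ false × IsUnionOf (class c ∷ L) A) ⇔ IsUnionOf L A
    isUnionOf-∌ A = mk⇔ to from
      where
      to : lookup A c ≡ false × IsUnionOf (class c ∷ L) A → IsUnionOf L A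
      to (c∉A , closed , A⊆) = closed , λ v v∈A →
        drop (λ c~v → contradiction (≡.trans (≡.sym v∈A) (≡.trans (≡.sym (closed c v c~v)) c∉A)) λ ()) (A⊆ v v∈A)

      from : IsUnionOf L A → lookup A c ≡ false × IsUnionOf (class c ∷ L) A
      from A∪L@(closed , A⊆L) = isUnionOf⇒∌ A A∪L , closed , λ v → there ∘ A⊆L v

    -- Here `A △ class c` is the union that contains `c`, and `A` is what remains when the class is
    -- taken away. The toggled set carries the condition because reindexing by `∑-△` produces it.
    isUnionOf-∋ : ∀ A → (lookup (A △ class c) c ≡ true × IsUnionOf (class c ∷ L) (A △ class c)) ⇔ IsUnionOf L A
    isUnionOf-∋ A = mk⇔ to from
      where
      lookup-△ : ∀ v → lookup (A △ class c) v ≡ lookup A v xor lookup (class c) v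
      lookup-△ v = Vec.lookup-zipWith _xor_ v A (class c)

      △-∈ : ∀ {v} → c ~ v → lookup (A △ class c) v ≡ not (lookup A v)
      △-∈ {v} c~v rewrite lookup-△ v | ~⇒lookup-class c~v = ≡.trans (Bool.xor-comm _ true) ≡.refl

      △-∉ : ∀ {v} → ¬ (c ~ v) → lookup (A △ class c) v ≡ lookup A v
      △-∉ {v} c≁v rewrite lookup-△ v | ≁⇒lookup-class c≁v = Bool.xor-identityʳ _

      to : lookup (A △ class c) c ≡ true × IsUnionOf (class c ∷ L) (A △ class c) → IsUnionOf L A
      to (c∈ , closed , ⊆L) = closedA , A⊆L
        where
        xor-cancelʳ : ∀ a b {s t} → s ≡ t → a xor s ≡ b xor t → a ≡ b
        xor-cancelʳ a b {true}  ≡.refl eq = Bool.not-injective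
          (≡.trans (Bool.xor-comm true a) (≡.trans eq (Bool.xor-comm b true)))
        xor-cancelʳ a b {false} ≡.refl eq =
          ≡.trans (≡.sym (Bool.xor-identityʳ a)) (≡.trans eq (Bool.xor-identityʳ b))

        closedA : Closed A
        closedA u v u~v = xor-cancelʳ (lookup A u) (lookup A v) (class-closed c u v u~v)
          (≡.trans (≡.sym (lookup-△ u)) (≡.trans (closed u v u~v) (lookup-△ v)))

        A⊆L : ∀ v → lookup A v ≡ true → class v ∈ₗ L
        A⊆L v v∈A with c ~? v
        -- That `c` lies in the toggled set means that it is not in `A`, and `A` is constant on the
        -- class of `c`.
        ... | yes c~v = contradiction
          (≡.trans (≡.sym c∈) (≡.trans (△-∈ ~.refl) (≡.cong not (≡.trans (closedA c v c~v) v∈A)))) λ ()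
        ... | no  c≁v = drop c≁v (⊆L v (≡.trans (△-∉ c≁v) v∈A))

      from : IsUnionOf L A → lookup (A △ class c) c ≡ true × IsUnionOf (class c ∷ L) (A △ class c)
      from A∪L@(closed , A⊆L) = ≡.trans (△-∈ ~.refl) (≡.cong not (isUnionOf⇒∌ A A∪L)) , closed△ , ⊆L
        where
        closed△ : Closed (A △ class c)
        closed△ u v u~v = ≡.trans (lookup-△ u)
          (≡.trans (≡.cong₂ _xor_ (closed u v u~v) (class-closed c u v u~v)) (≡.sym (lookup-△ v)))

        ⊆L : ∀ v → lookup (A △ class c) v ≡ true → class v ∈ₗ class c ∷ L
        ⊆L v v∈ with c ~? v
        ... | yes c~v = here (≡.sym (class-cong c~v))
        ... | no  c≁v = there (A⊆L v (≡.trans (≡.sym (△-∉ c≁v)) v∈))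

  module _ {c ℓ₁ ℓ₂ ℓ₃} (F : OrderedField c ℓ₁ ℓ₂ ℓ₃) (G : Graph) (ƛ : Fin n → OrderedField.Carrier F) where

    open OrderedField F
    open Model F G using (∏∈; ∑Subsets)
    open SubsetSums F G
    open SetoidReasoning setoid

    -- For L = class c ∷ L′, the map A ↦ A △ class c is a bijection between the
    -- unions that avoid c, which are the unions of L′, and those that contain c.
    ∑-unions : (L : List (Subset n)) → All (λ C → ∃ λ c → C ≡ class c) L → Unique L →
               ∑Subsets (λ A → if does (isUnionOf? L A) then ∏∈ A ƛ else 0#)
               ≈ foldr _*_ 1# (map (λ C → 1# + ∏∈ C ƛ) L)
    ∑-unions [] [] [] = begin
      ∑Subsets (λ A → if does (isUnionOf? [] A) then ∏∈ A ƛ else 0#)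
        -- With an empty list only the empty set is left, and it contributes the empty product.
        ≈⟨ ∑-cong (λ A → reflexive (≡.cong (if_then ∏∈ A ƛ else 0#) (does-⇔ empty (isUnionOf? [] A) (⊥ ≟ₛ A)))) ⟩
      ∑Subsets (λ A → if does (⊥ ≟ₛ A) then ∏∈ A ƛ else 0#)
        ≈⟨ ∑-point ⊥ (λ A → ∏∈ A ƛ) ⟩
      ∏∈ ⊥ ƛ
        ≈⟨ ∏-≈1 {n} _ (λ i → reflexive (≡.cong (if_then ƛ i else 1#) (lookup-⊥ i))) ⟩
      1# ∎
      where
      lookup-⊥ : ∀ i → lookup (⊥ {n}) i ≡ false
      lookup-⊥ i = Vec.lookup-replicate i false

      empty : ∀ {A} → IsUnionOf [] A ⇔ (⊥ ≡ A)
      empty {A} = mk⇔ (λ (_ , A⊆[]) → lookup-injective λ i → ≡.trans (lookup-⊥ i) (≡.sym (none A⊆[] i)))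
        λ { ≡.refl → (λ u v _ → ≡.trans (lookup-⊥ u) (≡.sym (lookup-⊥ v))) ,
            λ v v∈⊥ → contradiction (≡.trans (≡.sym v∈⊥) (lookup-⊥ v)) λ () }
        where
        none : (∀ v → lookup A v ≡ true → class v ∈ₗ []) → ∀ v → lookup A v ≡ false
        none A⊆[] v with lookup A v | A⊆[] v
        ... | false | _ = ≡.refl
        ... | true  | v∈[] = contradiction (v∈[] ≡.refl) λ ()
    ∑-unions (_ ∷ L) ((c , ≡.refl) ∷ classes) (c∉L ∷ unique) = begin
      ∑Subsets (λ A → weight (C ∷ L) A)
        ≈⟨ ∑-cong (λ A → splitOn A) ⟩
      ∑Subsets (λ A → (if does (c∉? A) then ∏∈ A ƛ else 0#) + (if does (c∈? A) then ∏∈ A ƛ else 0#))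
        ≈⟨ ∑-distrib-+ {n} _ _ ⟩
      ∑Subsets (λ A → if does (c∉? A) then ∏∈ A ƛ else 0#) + ∑Subsets (λ A → if does (c∈? A) then ∏∈ A ƛ else 0#)
        ≈⟨ +-congˡ (≈-sym (∑-△ C _)) ⟩
      ∑Subsets (λ A → if does (c∉? A) then ∏∈ A ƛ else 0#)
        + ∑Subsets (λ A → if does (c∈? (A △ C)) then ∏∈ (A △ C) ƛ else 0#)
        ≈⟨ +-cong (∑-cong λ A → reflexive (≡.cong (if_then ∏∈ A ƛ else 0#) (does-⇔ (isUnionOf-∌ c∉ A) (c∉? A) (isUnionOf? L A))))
                  (∑-cong weight-△) ⟩
      ∑Subsets (weight L) + ∑Subsets (λ A → ∏∈ C ƛ * weight L A)
        ≈⟨ +-cong (≈-sym (*-identityˡ _)) (*-distribˡ-∑ {n} _ _) ⟩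
      1# * ∑Subsets (weight L) + ∏∈ C ƛ * ∑Subsets (weight L)
        ≈⟨ distribʳ _ _ _ ⟨
      (1# + ∏∈ C ƛ) * ∑Subsets (weight L)
        ≈⟨ *-congˡ (∑-unions L classes unique) ⟩
      (1# + ∏∈ C ƛ) * foldr _*_ 1# (map (λ C → 1# + ∏∈ C ƛ) L) ∎
      where
      C = class c

      c∉ : C ∉ₗ L
      c∉ = All.All¬⇒¬Any c∉L

      weight : List (Subset n) → Subset n → Carrier
      weight L A = if does (isUnionOf? L A) then ∏∈ A ƛ else 0#

      c∉? : ∀ A → Dec (lookup A c ≡ false × IsUnionOf (C ∷ L) A)
      c∉? A = (lookup A c Bool.≟ false) ×-dec isUnionOf? (C ∷ L) A

      c∈? : ∀ A → Dec (lookup A c ≡ true × IsUnionOf (C ∷ L) A)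
      c∈? A = (lookup A c Bool.≟ true) ×-dec isUnionOf? (C ∷ L) A

      splitOn : ∀ A → weight (C ∷ L) A ≈ (if does (c∉? A) then ∏∈ A ƛ else 0#) + (if does (c∈? A) then ∏∈ A ƛ else 0#)
      splitOn A with lookup A c
      -- Once the state of `c` is known, one of the two conditions computes to `false` and the other
      -- to the original condition.
      ... | false = ≈-sym (+-identityʳ _)
      ... | true  = ≈-sym (+-identityˡ _)

      weight-△ : ∀ A → (if does (c∈? (A △ C)) then ∏∈ (A △ C) ƛ else 0#) ≈ ∏∈ C ƛ * weight L A
      weight-△ A = ≈-trans
        (reflexive (≡.cong (if_then ∏∈ (A △ C) ƛ else 0#)
          (does-⇔ (isUnionOf-∋ c∉ A) (c∈? (A △ C)) (isUnionOf? L A))))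
        (≈-trans (if-does-cong (isUnionOf? L A) λ A∪L →
            ≈-trans (∏∈-△ A C ƛ (isUnionOf⇒disjoint c∉ A A∪L)) (*-comm _ _))
          (≈-sym (*-if (does (isUnionOf? L A)) _ _)))

-- Components of an edge set, and vertex sets that none of its edges leaves.

connected-isEquivalence : ∀ {n m} (ends : Fin m → Fin n × Fin n) (S : Subset m) →
                          IsEquivalence (Connectivity.Connected ends S)
connected-isEquivalence ends S = record
  { refl  = ε
  ; sym   = reverse λ { (e , e∈S , inj₁ eq) → e , e∈S , inj₂ eq ; (e , e∈S , inj₂ eq) → e , e∈S , inj₁ eq }
  ; trans = _◅◅_
  }

module SubgraphWorld {c ℓ₁ ℓ₂ ℓ₃} (F : OrderedField c ℓ₁ ℓ₂ ℓ₃) (G : Graph) where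

  open OrderedField F
  open Model F G
  open OrderedFieldProperties F
  open SubsetSums F G
  open CommutativeRing commutativeRing using (ring; *-commutativeMonoid; *-commutativeSemigroup)
  open CommutativeSemigroupProperties *-commutativeSemigroup
    using (x∙yz≈y∙xz)
  open RingProperties ring using (-1*x≈-x; -‿involutive)
  open SetoidReasoning setoid
  open CommutativeMonoidSolver *-commutativeMonoid using (solve; _⊜_; _⊕_)

  module Components (R : EdgeSet) = Classes (connected-isEquivalence ends R) (Connectivity.connected? ends R)

  source target : E → V
  source e = proj₁ (ends e)
  target e = proj₂ (ends e)

  -- The local form of closedness under connectivity: one condition per edge, so that the indicator
  -- factors over the edges.
  Uncut : EdgeSet → VertexSet → E → Set
  Uncut R A e = lookup R e ≡ true → lookup A (source e) ≡ lookup A (target e)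

  uncut? : ∀ R A e → Dec (Uncut R A e)
  uncut? R A e = (lookup R e Bool.≟ true) →-dec (lookup A (source e) Bool.≟ lookup A (target e))

  isUnionOf-κ⇒uncut : ∀ R A → Components.IsUnionOf R (κ R) A → ∀ e → Uncut R A e
  isUnionOf-κ⇒uncut R A (closed , _) e e∈R =
    closed (source e) (target e) ((e , Vec.lookup⇒[]= e R e∈R , inj₁ ≡.refl) ◅ ε)

  -- Membership in `A` is carried along each walk edge by edge, and `κ R` lists the component of
  -- every vertex.
  uncut⇒isUnionOf-κ : ∀ R A → (∀ e → Uncut R A e) → Components.IsUnionOf R (κ R) A
  uncut⇒isUnionOf-κ R A uncut = closed , λ v _ → ∈-deduplicate⁺ _≟ₛ_ (∈-map⁺ (component R) (∈-allFin v))
    where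
    closed : Components.Closed R A
    closed u .u ε = ≡.refl
    closed u v ((e , e∈R , inj₁ eq) ◅ walk) with ends e | eq | uncut e (Vec.[]=⇒lookup e∈R)
    ... | _ | ≡.refl | Au≡Aw = ≡.trans Au≡Aw (closed _ v walk)
    closed u v ((e , e∈R , inj₂ eq) ◅ walk) with ends e | eq | uncut e (Vec.[]=⇒lookup e∈R)
    ... | _ | ≡.refl | Aw≡Au = ≡.trans (≡.sym Aw≡Au) (closed _ v walk)

  -- The sets that no edge of `R` leaves are the unions of components, and expanding the cluster
  -- product chooses freely which components to include.
  ∏-κ : ∀ R (ƛ : V → Carrier) →
        ∑Subsets (λ A → ∏∈ A ƛ * ∏ (λ e → ⟦ does (uncut? R A e) ⟧))
        ≈ foldr _*_ 1# (map (λ C → 1# + ∏∈ C ƛ) (κ R))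
  ∏-κ R ƛ = begin
    ∑Subsets (λ A → ∏∈ A ƛ * ∏ (λ e → ⟦ does (uncut? R A e) ⟧))
      ≈⟨ ∑-cong (λ A → *-congˡ (∏-⟦⟧ (uncut? R A) (Components.isUnionOf? R (κ R) A)
           (isUnionOf-κ⇒uncut R A) (uncut⇒isUnionOf-κ R A))) ⟩
    ∑Subsets (λ A → ∏∈ A ƛ * ⟦ does (Components.isUnionOf? R (κ R) A) ⟧)
      ≈⟨ ∑-cong (λ A → ≈-sym (if≈*⟦⟧ (does (Components.isUnionOf? R (κ R) A)) _)) ⟩
    ∑Subsets (λ A → if does (Components.isUnionOf? R (κ R) A) then ∏∈ A ƛ else 0#)
      ≈⟨ Components.∑-unions R F G ƛ (κ R) (All.tabulate classes) (deduplicate-! _≟ₛ_ _) ⟩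
    foldr _*_ 1# (map (λ C → 1# + ∏∈ C ƛ) (κ R)) ∎
    where
    classes : ∀ {C} → C ∈ₗ κ R → ∃ λ v → C ≡ component R v
    classes C∈κ with ∈-map⁻ (component R) (∈-deduplicate⁻ _≟ₛ_ (map (component R) (allFin #V)) C∈κ)
    ... | v , _ , eq = v , eq

  -- Degree parities as signs.

  sgn : Bool → Carrier
  sgn b = if b then - 1# else 1#

  -1*-1≈1 : - 1# * - 1# ≈ 1#
  -1*-1≈1 = ≈-trans (-1*x≈-x (- 1#)) (-‿involutive 1#)

  sgn-suc : ∀ k → - 1# * sgn (k % 2 ≡ᵇ 1) ≈ sgn (suc k % 2 ≡ᵇ 1)
  sgn-suc zero          = *-identityʳ _
  sgn-suc (suc zero)    = -1*-1≈1
  -- The remainder modulo 2 computes to the same value after two successors.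
  sgn-suc (suc (suc k)) = sgn-suc k

  ∏-sgn : ∀ {m} (B : Subset m) → ∏ (λ i → sgn (lookup B i)) ≈ sgn (∣ B ∣ % 2 ≡ᵇ 1)
  ∏-sgn []            = ≈-refl
  ∏-sgn (outside ∷ B) = ≈-trans (*-identityˡ _) (∏-sgn B)
  ∏-sgn (inside ∷ B)  = ≈-trans (*-congˡ (∏-sgn B)) (sgn-suc ∣ B ∣)

  isEnd : V → E → Bool
  isEnd v e = does (v Fin.≟ source e) ∨ does (v Fin.≟ target e)

  -- Each edge of `S` that ends in `v` adds one to the degree, hence one factor -1 to the sign.
  sgn-odd : ∀ S v → sgn (lookup (odd S) v) ≈ ∏ (λ e → sgn (lookup S e ∧ isEnd v e))
  sgn-odd S v = begin
    sgn (lookup (odd S) v)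
      ≡⟨ ≡.cong sgn (Vec.lookup∘tabulate (λ v → degree S v % 2 ≡ᵇ 1) v) ⟩
    sgn (degree S v % 2 ≡ᵇ 1)
      ≈⟨ ∏-sgn (S ∩ incident v) ⟨
    ∏ (λ e → sgn (lookup (S ∩ incident v) e))
      ≈⟨ ∏-cong (λ e → reflexive (≡.cong sgn (lookup-∩ e))) ⟩
    ∏ (λ e → sgn (lookup S e ∧ isEnd v e)) ∎
    where
    lookup-∩ : ∀ e → lookup (S ∩ incident v) e ≡ lookup S e ∧ isEnd v e
    lookup-∩ e = ≡.trans (Vec.lookup-zipWith _∧_ e S (incident v))
      (≡.cong (lookup S e ∧_) (Vec.lookup∘tabulate (isEnd v) e))

  -- It is -1 if exactly one end of `e` lies in `A`, and 1 otherwise.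
  crossing : VertexSet → E → Carrier
  crossing A e = sgn (lookup A (source e)) * sgn (lookup A (target e))

  ∏∈-isEnd : ∀ A e → ∏∈ A (λ v → sgn (isEnd v e)) ≈ crossing A e
  ∏∈-isEnd A e = begin
    ∏∈ A (λ v → sgn (isEnd v e))
      ≈⟨ ∏-cong pointwise ⟩
    ∏ (λ v → at (source e) v * at (target e) v)
      ≈⟨ ∏-distrib-* (at (source e)) (at (target e)) ⟩
    ∏ (at (source e)) * ∏ (at (target e))
      ≈⟨ *-cong (∏-point (sgn ∘ lookup A) (source e)) (∏-point (sgn ∘ lookup A) (target e)) ⟩
    crossing A e ∎
    where
    at : V → V → Carrier
    at a v = if does (v Fin.≟ a) then sgn (lookup A v) else 1#

    pointwise : ∀ v → (if lookup A v then sgn (isEnd v e) else 1#) ≈ at (source e) v * at (target e) v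
    pointwise v with lookup A v | v Fin.≟ source e | v Fin.≟ target e
    -- No vertex is both ends of `e`: edges are not loops, since their ends are strictly ordered.
    ... | _     | yes p | yes q = contradiction (≡.trans (≡.sym p) q) (Fin.<⇒≢ (ordered e))
    ... | true  | yes _ | no _  = ≈-sym (*-identityʳ _)
    ... | true  | no _  | yes _ = ≈-sym (*-identityˡ _)
    ... | true  | no _  | no _  = ≈-sym (*-identityˡ _)
    ... | false | yes _ | no _  = ≈-sym (*-identityˡ _)
    ... | false | no _  | yes _ = ≈-sym (*-identityˡ _)
    ... | false | no _  | no _  = ≈-sym (*-identityˡ _)

  -- Double counting of the incidences between `A` and `S`: read edge by edge, the two signs of an
  -- edge inside `A` cancel, and one sign is left for each edge that leaves `A`.
  ∏∈-sgn-odd : ∀ A S → ∏∈ A (λ v → sgn (lookup (odd S) v)) ≈ ∏∈ S (crossing A)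
  ∏∈-sgn-odd A S = begin
    ∏∈ A (λ v → sgn (lookup (odd S) v))
      ≈⟨ ∏-cong (λ v → ≈-trans (if-≈ (lookup A v) (sgn-odd S v) ≈-refl) (pull (lookup A v) v)) ⟩
    ∏ (λ v → ∏ λ e → if lookup A v then sgn (lookup S e ∧ isEnd v e) else 1#)
      ≈⟨ ∏-comm (λ v e → if lookup A v then sgn (lookup S e ∧ isEnd v e) else 1#) ⟩
    ∏ (λ e → ∏ λ v → if lookup A v then sgn (lookup S e ∧ isEnd v e) else 1#)
      ≈⟨ ∏-cong (λ e → atEdge e (lookup S e)) ⟩
    ∏∈ S (crossing A) ∎
    where
    pull : ∀ b v → (if b then ∏ (λ e → sgn (lookup S e ∧ isEnd v e)) else 1#)
                   ≈ ∏ (λ e → if b then sgn (lookup S e ∧ isEnd v e) else 1#)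
    pull true  v = ≈-refl
    pull false v = ≈-sym (∏-≈1 {#E} _ λ _ → ≈-refl)

    atEdge : ∀ e s → ∏ (λ v → if lookup A v then sgn (s ∧ isEnd v e) else 1#)
                     ≈ (if s then crossing A e else 1#)
    atEdge e true  = ∏∈-isEnd A e
    atEdge e false = ∏-≈1 {#V} _ λ v → if-const (lookup A v) ≈-refl

  ∏∈-distrib-* : ∀ {n} (A : Subset n) (f g : Fin n → Carrier) →
                 ∏∈ A (λ i → f i * g i) ≈ ∏∈ A f * ∏∈ A g
  ∏∈-distrib-* {n} A f g = ≈-trans (∏-cong λ i → pointwise (lookup A i) i) (∏-distrib-* {n} _ _)
    where
    pointwise : ∀ b i → (if b then f i * g i else 1#) ≈ (if b then f i else 1#) * (if b then g i else 1#)
    pointwise true  i = ≈-refl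
    pointwise false i = ≈-sym (*-identityˡ 1#)

  -- The first factor of the summand is the indicator of `S ⊆ R`. The sum factors over the edges: an
  -- edge of `R` gives `1 + 1` if it does not leave `A` and `1 - 1` if it does, and an edge outside
  -- `R` gives 1.
  ∑-⊆-crossing : ∀ R A → ∑Subsets (λ S → ∏∈ S (⟦_⟧ ∘ lookup R) * ∏∈ S (crossing A))
                         ≈ ∏∈ R (λ _ → 2#) * ∏ (λ e → ⟦ does (uncut? R A e) ⟧)
  ∑-⊆-crossing R A = begin
    ∑Subsets (λ S → ∏∈ S (⟦_⟧ ∘ lookup R) * ∏∈ S (crossing A))
      ≈⟨ ∑-cong {#E} (λ S → ≈-sym (∏∈-distrib-* S _ _)) ⟩
    ∑Subsets (λ S → ∏∈ S (λ e → ⟦ lookup R e ⟧ * crossing A e))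
      ≈⟨ ∑-∏ (λ e s → if s then ⟦ lookup R e ⟧ * crossing A e else 1#) ⟩
    ∏ (λ e → 1# + ⟦ lookup R e ⟧ * crossing A e)
      ≈⟨ ∏-cong (λ e → pointwise (lookup R e) (lookup A (source e)) (lookup A (target e))) ⟩
    ∏ (λ e → (if lookup R e then 2# else 1#) * ⟦ does (uncut? R A e) ⟧)
      ≈⟨ ∏-distrib-* {#E} _ _ ⟩
    ∏∈ R (λ _ → 2#) * ∏ (λ e → ⟦ does (uncut? R A e) ⟧) ∎
    where
    cancels : ∀ {x} → x ≈ - 1# → 1# + 1# * x ≈ 2# * 0#
    cancels x≈-1 = ≈-trans (+-congˡ (≈-trans (*-identityˡ _) x≈-1))
      (≈-trans (-‿inverseʳ 1#) (≈-sym (zeroʳ _)))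

    doubles : ∀ {x} → x ≈ 1# → 1# + 1# * x ≈ 2# * 1#
    doubles x≈1 = ≈-trans (+-congˡ (≈-trans (*-identityˡ _) x≈1)) (≈-sym (*-identityʳ _))

    pointwise : ∀ r a b → 1# + ⟦ r ⟧ * (sgn a * sgn b)
                ≈ (if r then 2# else 1#) * ⟦ does ((r Bool.≟ true) →-dec (a Bool.≟ b)) ⟧
    pointwise true  true  true  = doubles -1*-1≈1
    pointwise true  true  false = cancels (*-identityʳ _)
    pointwise true  false true  = cancels (*-identityˡ _)
    pointwise true  false false = doubles (*-identityˡ _)
    pointwise false a     b     = ≈-trans (+-congˡ (zeroˡ _))
      (≈-trans (+-identityʳ _) (≈-sym (*-identityʳ _)))

  -- Odd-degree weights turned into cluster weights.

  module _ (η ƛ : V → Carrier) (1+ƛ#0 : ∀ v → 1# + ƛ v # 0#)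
           (η≈ : ∀ v → η v ≈ (1# - ƛ v) / (1# + ƛ v) [ 1+ƛ#0 v ]) where

    [1+ƛ]*η≈1-ƛ : ∀ v → (1# + ƛ v) * η v ≈ 1# - ƛ v
    [1+ƛ]*η≈1-ƛ v = begin
      (1# + ƛ v) * η v                                ≈⟨ *-congˡ (η≈ v) ⟩
      (1# + ƛ v) * ((1# - ƛ v) * recip (1+ƛ#0 v))     ≈⟨ x∙yz≈y∙xz _ _ _ ⟩
      (1# - ƛ v) * ((1# + ƛ v) * recip (1+ƛ#0 v))     ≈⟨ *-congˡ (recip-inverseʳ (1+ƛ#0 v)) ⟩
      (1# - ƛ v) * 1#                                 ≈⟨ *-identityʳ _ ⟩
      1# - ƛ v                                        ∎

    -- Clearing denominators leaves `1 - ƛ v` at odd vertices and `1 + ƛ v` at the others. In the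
    -- expansion of these binomials, `A` is the set of vertices where the second term is chosen.
    ∏∈-odd : ∀ S → ∏ (λ v → 1# + ƛ v) * ∏∈ (odd S) η ≈ ∑Subsets (λ A → ∏∈ A ƛ * ∏∈ S (crossing A))
    ∏∈-odd S = begin
      ∏ (λ v → 1# + ƛ v) * ∏∈ (odd S) η
        ≈⟨ ∏-distrib-* (λ v → 1# + ƛ v) _ ⟨
      ∏ (λ v → (1# + ƛ v) * (if lookup (odd S) v then η v else 1#))
        ≈⟨ ∏-cong (λ v → pointwise v (lookup (odd S) v)) ⟩
      ∏ (λ v → 1# + ƛ v * sgn (lookup (odd S) v))
        ≈⟨ ∑-∏ (λ v a → if a then ƛ v * sgn (lookup (odd S) v) else 1#) ⟨
      ∑Subsets (λ A → ∏∈ A (λ v → ƛ v * sgn (lookup (odd S) v)))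
        ≈⟨ ∑-cong (λ A → ≈-trans (∏∈-distrib-* A _ _) (*-congˡ (∏∈-sgn-odd A S))) ⟩
      ∑Subsets (λ A → ∏∈ A ƛ * ∏∈ S (crossing A)) ∎
      where
      pointwise : ∀ v b → (1# + ƛ v) * (if b then η v else 1#) ≈ 1# + ƛ v * sgn b
      pointwise v true  = ≈-trans ([1+ƛ]*η≈1-ƛ v)
        (+-congˡ (≈-trans (≈-sym (-1*x≈-x (ƛ v))) (*-comm _ _)))
      pointwise v false = ≈-trans (*-identityʳ _) (+-congˡ (≈-sym (*-identityʳ _)))

    ∑-⊆-odd : ∀ R → ∏ (λ v → 1# + ƛ v) * ∑Subsets (λ S → ∏∈ S (⟦_⟧ ∘ lookup R) * ∏∈ (odd S) η)
              ≈ ∏∈ R (λ _ → 2#) * foldr _*_ 1# (map (λ C → 1# + ∏∈ C ƛ) (κ R))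
    ∑-⊆-odd R = begin
      D * ∑Subsets (λ S → in-R S * ∏∈ (odd S) η)
        ≈⟨ *-distribˡ-∑ {#E} D _ ⟨
      ∑Subsets (λ S → D * (in-R S * ∏∈ (odd S) η))
        ≈⟨ ∑-cong (λ S → ≈-trans (x∙yz≈y∙xz _ _ _) (*-congˡ (∏∈-odd S))) ⟩
      ∑Subsets (λ S → in-R S * ∑Subsets (λ A → ∏∈ A ƛ * ∏∈ S (crossing A)))
        ≈⟨ ∑-cong (λ S → ≈-sym (*-distribˡ-∑ {#V} (in-R S) _)) ⟩
      ∑Subsets (λ S → ∑Subsets (λ A → in-R S * (∏∈ A ƛ * ∏∈ S (crossing A))))
        -- With `A` fixed, the sum over `S` becomes a product over the edges.
        ≈⟨ ∑-comm {#V} {#E} _ ⟩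
      ∑Subsets (λ A → ∑Subsets (λ S → in-R S * (∏∈ A ƛ * ∏∈ S (crossing A))))
        ≈⟨ ∑-cong (λ A → ≈-trans (∑-cong {#E} λ S → x∙yz≈y∙xz _ _ _) (*-distribˡ-∑ {#E} (∏∈ A ƛ) _)) ⟩
      ∑Subsets (λ A → ∏∈ A ƛ * ∑Subsets (λ S → in-R S * ∏∈ S (crossing A)))
        ≈⟨ ∑-cong (λ A → ≈-trans (*-congˡ (∑-⊆-crossing R A)) (x∙yz≈y∙xz _ _ _)) ⟩
      ∑Subsets (λ A → ∏∈ R (λ _ → 2#) * (∏∈ A ƛ * ∏ (λ e → ⟦ does (uncut? R A e) ⟧)))
        ≈⟨ *-distribˡ-∑ {#V} (∏∈ R (λ _ → 2#)) _ ⟩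
      ∏∈ R (λ _ → 2#) * ∑Subsets (λ A → ∏∈ A ƛ * ∏ (λ e → ⟦ does (uncut? R A e) ⟧))
        ≈⟨ *-congˡ (∏-κ R ƛ) ⟩
      ∏∈ R (λ _ → 2#) * foldr _*_ 1# (map (λ C → 1# + ∏∈ C ƛ) (κ R)) ∎
      where
      D = ∏ λ v → 1# + ƛ v
      in-R : EdgeSet → Carrier
      in-R S = ∏∈ S (⟦_⟧ ∘ lookup R)

  -- Independent addition of edges.

  bernoulli≈∏ : ∀ r T → bernoulli r T ≈ ∏ (λ e → if lookup T e then r e else 1# - r e)
  bernoulli≈∏ r T = ∏∈-∏∈∁ T r (λ e → 1# - r e)

  ∑-bernoulli : ∀ r → ∑Subsets (bernoulli r) ≈ 1#
  ∑-bernoulli r = begin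
    ∑Subsets (bernoulli r)
      ≈⟨ ∑-cong (bernoulli≈∏ r) ⟩
    ∑Subsets (λ T → ∏ λ e → if lookup T e then r e else 1# - r e)
      ≈⟨ ∑-∏ (λ e t → if t then r e else 1# - r e) ⟩
    ∏ (λ e → 1# - r e + r e)
      ≈⟨ ∏-≈1 {#E} _ (λ e → ≈-trans (+-assoc _ _ _) (≈-trans (+-congˡ (-‿inverseˡ _)) (+-identityʳ _))) ⟩
    1# ∎

  bernoulli-nonneg : ∀ r → (∀ e → 0# ≤ r e) → (∀ e → 0# ≤ 1# - r e) → ∀ T → 0# ≤ bernoulli r T
  bernoulli-nonneg r 0≤r 0≤1-r T = *-nonneg
    (∏-nonneg _ λ e → if-nonneg (lookup T e) (0≤r e)) (∏-nonneg _ λ e → if-nonneg (lookup (∁ T) e) (0≤1-r e))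
    where
    if-nonneg : ∀ b {x} → 0# ≤ x → 0# ≤ (if b then x else 1#)
    if-nonneg true  0≤x = 0≤x
    if-nonneg false _   = 0≤1

  addEdges-nonneg : ∀ r π → (∀ T → 0# ≤ bernoulli r T) → (∀ S → 0# ≤ π S) → ∀ R → 0# ≤ addEdges r π R
  addEdges-nonneg r π 0≤ber 0≤π R = ∑-nonneg _ λ S → ∑-nonneg _ λ T →
    if-nonneg (does ((S ∪ T) ≟ₛ R)) (*-nonneg (0≤π S) (0≤ber T))
    where
    if-nonneg : ∀ b {x} → 0# ≤ x → 0# ≤ (if b then x else 0#)
    if-nonneg true  0≤x = 0≤x
    if-nonneg false _   = IsStrictPartialOrder.irrefl isStrictPartialOrder ≈-refl

  -- Each pair `S`, `T` has exactly one union, so summing over `R` first removes the condition, and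
  -- the coins have total mass one.
  ∑-addEdges : ∀ r π → ∑Subsets (addEdges r π) ≈ ∑Subsets π
  ∑-addEdges r π = begin
    ∑Subsets (λ R → ∑Subsets λ S → ∑Subsets λ T → term R S T)
      ≈⟨ ∑-comm (λ R S → ∑Subsets λ T → term R S T) ⟩
    ∑Subsets (λ S → ∑Subsets λ R → ∑Subsets λ T → term R S T)
      ≈⟨ ∑-cong (λ S → ∑-comm (λ R T → term R S T)) ⟩
    ∑Subsets (λ S → ∑Subsets λ T → ∑Subsets λ R → term R S T)
      ≈⟨ ∑-cong (λ S → ∑-cong λ T → ∑-point (S ∪ T) (λ _ → π S * bernoulli r T)) ⟩
    ∑Subsets (λ S → ∑Subsets λ T → π S * bernoulli r T)
      ≈⟨ ∑-cong (λ S → ≈-trans (*-distribˡ-∑ (π S) (bernoulli r))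
           (≈-trans (*-congˡ (∑-bernoulli r)) (*-identityʳ _))) ⟩
    ∑Subsets π ∎
    where
    term : EdgeSet → EdgeSet → EdgeSet → Carrier
    term R S T = if does ((S ∪ T) ≟ₛ R) then π S * bernoulli r T else 0#

  -- The probability that an edge in state s is in state b after the addition.
  transition : Carrier → Bool → Bool → Carrier
  transition r s b = (1# - r) * ⟦ does ((s ∨ false) Bool.≟ b) ⟧ + r * ⟦ does ((s ∨ true) Bool.≟ b) ⟧

  -- The law of the coins and the indicator of `S ∪ T = R` are both products over the edges, so the
  -- sum over `T` splits into one transition per edge.
  ∑-∪ : ∀ r (S R : EdgeSet) x → ∑Subsets (λ T → if does ((S ∪ T) ≟ₛ R) then x * bernoulli r T else 0#)
        ≈ x * ∏ (λ e → transition (r e) (lookup S e) (lookup R e))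
  ∑-∪ r S R x = begin
    ∑Subsets (λ T → if does ((S ∪ T) ≟ₛ R) then x * bernoulli r T else 0#)
      ≈⟨ ∑-cong (λ T → ≈-trans (if≈*⟦⟧ (does ((S ∪ T) ≟ₛ R)) _) (*-assoc _ _ _)) ⟩
    ∑Subsets (λ T → x * (bernoulli r T * ⟦ does ((S ∪ T) ≟ₛ R) ⟧))
      ≈⟨ *-distribˡ-∑ {#E} x _ ⟩
    x * ∑Subsets (λ T → bernoulli r T * ⟦ does ((S ∪ T) ≟ₛ R) ⟧)
      ≈⟨ *-congˡ (∑-cong λ T → ≈-trans (*-cong (bernoulli≈∏ r T) (⟦≟⟧≈∏ (S ∪ T) R)) (≈-sym (∏-distrib-* {#E} _ _))) ⟩
    x * ∑Subsets (λ T → ∏ λ e → (if lookup T e then r e else 1# - r e) * ⟦ does (lookup (S ∪ T) e Bool.≟ lookup R e) ⟧)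
      ≈⟨ *-congˡ (∑-cong λ T → ∏-cong λ e → *-congˡ (reflexive
           (≡.cong (λ b → ⟦ does (b Bool.≟ lookup R e) ⟧) (Vec.lookup-zipWith _∨_ e S T)))) ⟩
    x * ∑Subsets (λ T → ∏ λ e → edge e (lookup T e))
      ≈⟨ *-congˡ (∑-∏ edge) ⟩
    x * ∏ (λ e → transition (r e) (lookup S e) (lookup R e)) ∎
    where
    edge : E → Bool → Carrier
    edge e t = (if t then r e else 1# - r e) * ⟦ does ((lookup S e ∨ t) Bool.≟ lookup R e) ⟧

  -- Present edges carry `p` rather than `2p`; the missing power of two comes from the sum over
  -- `S ⊆ R`.
  edgeWeight : (E → Carrier) → EdgeSet → Carrier
  edgeWeight p R = ∏∈ R p * ∏∈ (∁ R) (λ e → 1# - 2# * p e)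

  module _ (p : E → Carrier) (p≤½ : ∀ e → p e ≤ ½) where

    -- The choice of `odds` makes the weight depend on the final state `b` alone. What remains of
    -- the initial state is the bracket, which forbids an edge of `S` to be missing from `R`.
    transition-weight : ∀ e s b →
      (if s then p e else 1# - p e) * transition (odds (p≤½ e)) s b
      ≈ (if b then p e else 1# - 2# * p e) * (if s then ⟦ b ⟧ else 1#)
    transition-weight e s b = go s b
      where
      r = odds (p≤½ e)

      first : (1# - r) * 1# + r * 0# ≈ 1# - r
      first = ≈-trans (+-cong (*-identityʳ _) (zeroʳ _)) (+-identityʳ _)

      second : (1# - r) * 0# + r * 1# ≈ r
      second = ≈-trans (+-cong (zeroʳ _) (*-identityʳ _)) (+-identityˡ _)

      go : ∀ s b → (if s then p e else 1# - p e) * transition r s b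
                   ≈ (if b then p e else 1# - 2# * p e) * (if s then ⟦ b ⟧ else 1#)
      -- An edge already present stays whatever its coin shows, so the two coin probabilities add up
      -- to one.
      go true true = *-congˡ (≈-trans (≈-sym (distribʳ _ _ _)) (≈-trans (*-identityʳ _)
        (≈-trans (+-assoc _ _ _) (≈-trans (+-congˡ (-‿inverseˡ _)) (+-identityʳ _)))))
      go true false = ≈-trans (*-congˡ (≈-trans (≈-sym (distribʳ _ _ _)) (zeroʳ _)))
        (≈-trans (zeroʳ _) (≈-sym (zeroʳ _)))
      go false true = ≈-trans (*-congˡ second) (≈-trans ([1-x]*odds≈x (p≤½ e)) (≈-sym (*-identityʳ _)))
      go false false = ≈-trans (*-congˡ first) (≈-trans ([1-x]*[1-odds]≈1-2x (p≤½ e)) (≈-sym (*-identityʳ _)))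

    ∏-transition-weight : ∀ S R →
      ∏∈ S p * ∏∈ (∁ S) (λ e → 1# - p e) * ∏ (λ e → transition (odds (p≤½ e)) (lookup S e) (lookup R e))
      ≈ edgeWeight p R * ∏∈ S (⟦_⟧ ∘ lookup R)
    ∏-transition-weight S R = begin
      ∏∈ S p * ∏∈ (∁ S) (λ e → 1# - p e) * ∏ k
        ≈⟨ *-congʳ (∏∈-∏∈∁ S p (λ e → 1# - p e)) ⟩
      ∏ (λ e → if lookup S e then p e else 1# - p e) * ∏ k
        ≈⟨ ∏-distrib-* {#E} _ _ ⟨
      ∏ (λ e → (if lookup S e then p e else 1# - p e) * k e)
        ≈⟨ ∏-cong (λ e → transition-weight e (lookup S e) (lookup R e)) ⟩
      ∏ (λ e → (if lookup R e then p e else 1# - 2# * p e) * (if lookup S e then ⟦ lookup R e ⟧ else 1#))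
        ≈⟨ ∏-distrib-* {#E} _ _ ⟩
      ∏ (λ e → if lookup R e then p e else 1# - 2# * p e) * ∏∈ S (⟦_⟧ ∘ lookup R)
        ≈⟨ *-congʳ (≈-sym (∏∈-∏∈∁ R p (λ e → 1# - 2# * p e))) ⟩
      edgeWeight p R * ∏∈ S (⟦_⟧ ∘ lookup R) ∎
      where
      k : E → Carrier
      k e = transition (odds (p≤½ e)) (lookup S e) (lookup R e)

    -- The edge weight depends only on `R` and leaves the sum over `S`, where the indicator of
    -- `S ⊆ R` and the parity weight remain.
    addEdges-sg : ∀ η π const → (∀ S → π S ≈ const * sgWeight p η S) → ∀ R →
      addEdges (λ e → odds (p≤½ e)) π R
      ≈ const * (edgeWeight p R * ∑Subsets (λ S → ∏∈ S (⟦_⟧ ∘ lookup R) * ∏∈ (odd S) η))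
    addEdges-sg η π const π≈ R = begin
      addEdges (λ e → odds (p≤½ e)) π R
        ≈⟨ ∑-cong (λ S → ∑-∪ _ S R (π S)) ⟩
      ∑Subsets (λ S → π S * k S)
        ≈⟨ ∑-cong (λ S → step S) ⟩
      ∑Subsets (λ S → const * (edgeWeight p R * (∏∈ S (⟦_⟧ ∘ lookup R) * ∏∈ (odd S) η)))
        ≈⟨ *-distribˡ-∑ {#E} const _ ⟩
      const * ∑Subsets (λ S → edgeWeight p R * (∏∈ S (⟦_⟧ ∘ lookup R) * ∏∈ (odd S) η))
        ≈⟨ *-congˡ (*-distribˡ-∑ {#E} (edgeWeight p R) _) ⟩
      const * (edgeWeight p R * ∑Subsets (λ S → ∏∈ S (⟦_⟧ ∘ lookup R) * ∏∈ (odd S) η)) ∎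
      where
      k : EdgeSet → Carrier
      k S = ∏ λ e → transition (odds (p≤½ e)) (lookup S e) (lookup R e)

      step : ∀ S → π S * k S ≈ const * (edgeWeight p R * (∏∈ S (⟦_⟧ ∘ lookup R) * ∏∈ (odd S) η))
      step S = begin
        π S * k S
          ≈⟨ *-congʳ (π≈ S) ⟩
        const * (∏∈ S p * ∏∈ (∁ S) (λ e → 1# - p e) * ∏∈ (odd S) η) * k S
          ≈⟨ solve 4 (λ c w h k → (c ⊕ (w ⊕ h)) ⊕ k ⊜ c ⊕ ((w ⊕ k) ⊕ h)) ≈-refl _ _ _ _ ⟩
        const * (∏∈ S p * ∏∈ (∁ S) (λ e → 1# - p e) * k S * ∏∈ (odd S) η)
          ≈⟨ *-congˡ (≈-trans (*-congʳ (∏-transition-weight S R)) (*-assoc _ _ _)) ⟩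
        const * (edgeWeight p R * (∏∈ S (⟦_⟧ ∘ lookup R) * ∏∈ (odd S) η)) ∎

lemma3p3 : ∀ {c ℓ₁ ℓ₂ ℓ₃} (F : OrderedField c ℓ₁ ℓ₂ ℓ₃) (G : Graph) →
    let open OrderedField F
        open Model F G
    in
    (p : E → Carrier) (η ƛ : V → Carrier)
    (0≤p : ∀ e → 0# ≤ p e) (p≤½ : ∀ e → p e ≤ ½) (0≤η : ∀ v → 0# ≤ η v)
    (1+ƛ#0 : ∀ v → 1# + ƛ v # 0#)
    (η≈ : ∀ v → η v ≈ (1# - ƛ v) / (1# + ƛ v) [ 1+ƛ#0 v ])
    (π : EdgeSet → Carrier) → π follows sgWeight p η →
    addEdges (λ e → p e / (1# - p e) [ x≤½⇒1-x#0 (p≤½ e) ]) π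
      follows wrcWeight (λ e → 2# * p e) ƛ
lemma3p3 F G p η ƛ 0≤p p≤½ 0≤η 1+ƛ#0 η≈ π π-follows = record
  { nonneg       = addEdges-nonneg _ π
      (bernoulli-nonneg _ (λ e → odds-nonneg (p≤½ e) (0≤p e)) (λ e → 1-odds-nonneg (p≤½ e) (0≤p e)))
      nonneg
  ; total        = ≈-trans (∑-addEdges _ π) total
  -- The factor `∏ D⁻¹` pays for the product of all `1# + ƛ v` that turns the subgraph sum into
  -- cluster weights.
  ; constant     = constant * ∏ D⁻¹
  ; proportional = proportional-wrc
  }
  where
  open OrderedField F
  open Model F G
  open OrderedFieldProperties F
  open SubsetSums F G
  open SubgraphWorld F G
  open CommutativeRing commutativeRing using (*-commutativeMonoid)
  open CommutativeMonoidSolver *-commutativeMonoid using (solve; _⊜_; _⊕_)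
  open SetoidReasoning setoid
  open _follows_ π-follows

  D D⁻¹ : V → Carrier
  D v   = 1# + ƛ v
  D⁻¹ v = recip (1+ƛ#0 v)

  ∏D⁻¹*∏D≈1 : ∏ D⁻¹ * ∏ D ≈ 1#
  ∏D⁻¹*∏D≈1 = ≈-trans (≈-sym (∏-distrib-* D⁻¹ D)) (∏-≈1 {#V} _ λ v → recip-inverseˡ (1+ƛ#0 v))

  proportional-wrc : ∀ R → addEdges (λ e → odds (p≤½ e)) π R ≈ constant * ∏ D⁻¹ * wrcWeight (λ e → 2# * p e) ƛ R
  proportional-wrc R = begin
    addEdges (λ e → odds (p≤½ e)) π R
      ≈⟨ addEdges-sg p p≤½ η π constant proportional R ⟩
    constant * (edgeWeight p R * subgraphSum)
      ≈⟨ *-congˡ (*-congˡ (≈-trans (≈-sym (*-identityˡ _)) (*-congʳ (≈-sym ∏D⁻¹*∏D≈1)))) ⟩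
    constant * (edgeWeight p R * (∏ D⁻¹ * ∏ D * subgraphSum))
      ≈⟨ *-congˡ (*-congˡ (≈-trans (*-assoc _ _ _) (*-congˡ (∑-⊆-odd η ƛ 1+ƛ#0 η≈ R)))) ⟩
    constant * (∏∈ R p * absent * (∏ D⁻¹ * (∏∈ R (λ _ → 2#) * clusters)))
      ≈⟨ solve 6 (λ c a b d t k → c ⊕ ((a ⊕ b) ⊕ (d ⊕ (t ⊕ k))) ⊜ (c ⊕ d) ⊕ (((t ⊕ a) ⊕ b) ⊕ k))
           ≈-refl _ _ _ _ _ _ ⟩
    constant * ∏ D⁻¹ * (∏∈ R (λ _ → 2#) * ∏∈ R p * absent * clusters)
      -- The factor 2 per edge of `R` turns `p` into `2p` on the present edges; the absent ones
      -- already carry `1 - 2p`.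
      ≈⟨ *-congˡ (*-congʳ (*-congʳ (≈-sym (∏∈-distrib-* R (λ _ → 2#) p)))) ⟩
    constant * ∏ D⁻¹ * wrcWeight (λ e → 2# * p e) ƛ R ∎
    where
    subgraphSum absent clusters : Carrier
    subgraphSum = ∑Subsets λ S → ∏∈ S (⟦_⟧ ∘ lookup R) * ∏∈ (odd S) η
    absent      = ∏∈ (∁ R) λ e → 1# - 2# * p e
    clusters    = foldr _*_ 1# (map (λ C → 1# + ∏∈ C ƛ) (κ R))
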